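{- For a finite bipartite graph $G$ (with bipartition $(X,Y)$) the following are equivalent: (i) $I(G)$ is a comparability graph; (ii) $\overline{G}$ has a $T$-free orientation; (iii) $G$ does not contain an invertible pair; (iv) $G$ does not contain a weak edge-asteroid; (v) $G$ does not contain an edge-asteroid; (vi) $\overline{I(G)}$ does not contain an asteroid.
   Context: Two edges $xy,x'y'$ of $G$ ($x,x'\in X$, $y,y'\in Y$) are independent if they are disjoint and $xy'\notin E(G)$, $x'y\notin E(G)$. $I(G)$ has vertex set $E(G)$, two edges adjacent iff independent; $\overline{I(G)}$ is its complement. A comparability graph is a graph admitting a transitive orientation. An orientation of the complement $\overline{G}$ is a mixed graph in which every non-edge $xy$ of $G$ with $x\in X,y\in Y$ is an undirected edge and every pair of distinct vertices both in $X$ or both in $Y$ is oriented in exactly one direction; it is $T$-free if there are no $x,x'\in X$, $y,y'\in Y$ with $xy,x'y'\notin E(G)$, $xy',x'y\in E(G)$, and arcs $x\to x'$, $y\to y'$. Two walks $a_1\dots a_k$, $b_1\dots b_k$ with $a_1,b_1$ in the same part are congruent if for each $i$ the edges $a_ia_{i+1}$, $b_ib_{i+1}$ are independent; $u,v$ is an invertible pair if there are congruent walks from $u$ to $v$ and from $v$ to $u$. An edge-asteroid is a set of $2k+1$ ($k\ge1$) distinct edges $e_0,\dots,e_{2k}$ such that for each $i$ there is a walk containing both end vertices of $e_{i+k}$ and of $e_{i+k+1}$ and no vertex adjacent to an end vertex of $e_i$ (indices mod $2k+1$); a weak edge-asteroid is the same but the edges $e_0,\dots,e_{2k}$ need not be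 distinct. An asteroid in a graph $H$ is a set of $2k+1$ vertices $v_0,\dots,v_{2k}$ ($k\ge1$) such that for each $i$ there is a path joining $v_{i+k}$ and $v_{i+k+1}$ containing no neighbour of $v_i$ (indices mod $2k+1$). -}

module Defs where

open import Data.Nat using (ℕ; zero; suc; _+_; _≤_)
open import Data.Nat.DivMod using (_mod_)
open import Data.Fin using (Fin; toℕ)
open import Data.Bool using (Bool; true; false)
open import Data.Sum using (_⊎_; inj₁; inj₂)
open import Data.Product using (Σ; _×_; _,_; proj₁; proj₂)
open import Data.Empty using (⊥)
import Data.Unit
import Data.Nat
open import Data.List using (List; []; _∷_)
open import Data.List.Relation.Unary.All using (All)
open import Data.List.Relation.Unary.Linked using (Linked)
open import Data.List.Relation.Unary.Unique.Propositional using (Unique)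
open import Data.List.Membership.Propositional using (_∈_)
open import Relation.Nullary using (¬_)
open import Relation.Binary.PropositionalEquality using (_≡_; _≢_)
open import Function.Definitions using (Injective)

-- Generic graph notions.  A graph is a vertex type V with an adjacency
-- relation A (assumed symmetric and irreflexive where it is used).

lastOr : {V : Set} → V → List V → V
lastOr u []       = u
lastOr u (x ∷ xs) = lastOr x xs

record WalkFromTo {V : Set} (A : V → V → Set) (a b : V) : Set where
  constructor walk
  field
    rest   : List V
    linked : Linked A (a ∷ rest)
    ends   : lastOr a rest ≡ b

record PathFromTo {V : Set} (A : V → V → Set) (a b : V) : Set where
  constructor path
  field
    rest   : List V
    linked : Linked A (a ∷ rest)
    ends   : lastOr a rest ≡ b
    unique : Unique (a ∷ rest)

pathVerts : {V : Set} {A : V → V → Set} {a b : V} → PathFromTo A a b → List V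
pathVerts {a = a} p = a ∷ PathFromTo.rest p

ExactlyOne : Set → Set → Set
ExactlyOne P Q = (P ⊎ Q) × ¬ (P × Q)

IsTransitiveOrientation : {V : Set} → (V → V → Set) → (V → V → Bool) → Set
IsTransitiveOrientation {V} A O =
  (∀ u v → A u v → ExactlyOne (O u v ≡ true) (O v u ≡ true)) ×
  (∀ u v → O u v ≡ true → A u v) ×
  (∀ u v w → O u v ≡ true → O v w ≡ true → O u w ≡ true)

IsComparabilityGraph : {V : Set} → (V → V → Set) → Set
IsComparabilityGraph {V} A = Σ (V → V → Bool) λ O → IsTransitiveOrientation A O

_⊕_ : ∀ {N} .{{_ : Data.Nat.NonZero N}} → Fin N → ℕ → Fin N
_⊕_ {N} i j = (toℕ i + j) mod N

Asteroid : {V : Set} → (V → V → Set) → Set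
Asteroid {V} A =
  Σ ℕ λ k → 1 ≤ k × Σ (Fin (suc (k + k)) → V) λ v → Injective _≡_ _≡_ v ×
    (∀ i → Σ (PathFromTo A (v (i ⊕ k)) (v (i ⊕ suc k))) λ p →
              All (λ w → ¬ A (v i) w) (pathVerts p))

module Bipartite {m n : ℕ} (adj : Fin m → Fin n → Bool) where

  E : Fin m → Fin n → Set
  E x y = adj x y ≡ true

  Vtx : Set
  Vtx = Fin m ⊎ Fin n

  Adj : Vtx → Vtx → Set
  Adj (inj₁ x) (inj₂ y) = E x y
  Adj (inj₂ y) (inj₁ x) = E x y
  Adj _        _        = ⊥

  Edge : Set
  Edge = Σ (Fin m × Fin n) λ p → E (proj₁ p) (proj₂ p)

  IndepXY : Fin m → Fin n → Fin m → Fin n → Set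
  IndepXY x y x' y' = E x y × E x' y' × x ≢ x' × y ≢ y' × ¬ E x y' × ¬ E x' y

  Independent : Edge → Edge → Set
  Independent ((x , y) , _) ((x' , y') , _) = IndepXY x y x' y'

  IG : Edge → Edge → Set
  IG = Independent

  coIG : Edge → Edge → Set
  coIG e f = e ≢ f × ¬ Independent e f

  Cond1 : Set
  Cond1 = IsComparabilityGraph IG

  -- (ii) orientations of the complement of G: the undirected edges (non-edges
  -- xy of G) are forced, so an orientation is a choice of a tournament on X
  -- and one on Y (relations given as Bool-valued functions).
  IsTournament : {W : Set} → (W → W → Bool) → Set
  IsTournament {W} R =
    (∀ a → ¬ (R a a ≡ true)) ×
    (∀ a b → a ≢ b → ExactlyOne (R a b ≡ true) (R b a ≡ true))

  TFree : (Fin m → Fin m → Bool) → (Fin n → Fin n → Bool) → Set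
  TFree RX RY = ∀ x x' y y' →
    ¬ (¬ E x y × ¬ E x' y' × E x y' × E x' y × RX x x' ≡ true × RY y y' ≡ true)

  Cond2 : Set
  Cond2 = Σ (Fin m → Fin m → Bool) λ RX → Σ (Fin n → Fin n → Bool) λ RY →
            IsTournament RX × IsTournament RY × TFree RX RY

  -- (iii) congruent walks a₁…a_k, b₁…b_k are encoded as the sequence of
  -- pairs (aᵢ , bᵢ); a step (a , b) → (a' , b') requires that aa', bb' be
  -- edges of G which are independent (with aᵢ, bᵢ in the same part).
  CongStep : Vtx × Vtx → Vtx × Vtx → Set
  CongStep (inj₁ x , inj₁ x') (inj₂ y , inj₂ y') = IndepXY x y x' y'
  CongStep (inj₂ y , inj₂ y') (inj₁ x , inj₁ x') = IndepXY x y x' y'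
  CongStep _ _ = ⊥

  SamePart : Vtx → Vtx → Set
  SamePart (inj₁ _) (inj₁ _) = Data.Unit.⊤
  SamePart (inj₂ _) (inj₂ _) = Data.Unit.⊤
  SamePart _ _ = ⊥

  InvertiblePair : Vtx → Vtx → Set
  InvertiblePair u v = SamePart u v × WalkFromTo CongStep (u , v) (v , u)

  Cond3 : Set
  Cond3 = ¬ (Σ Vtx λ u → Σ Vtx λ v → u ≢ v × InvertiblePair u v)

  endsIn : Edge → List Vtx → Set
  endsIn ((x , y) , _) ws = inj₁ x ∈ ws × inj₂ y ∈ ws

  avoidsNbhd : Edge → List Vtx → Set
  avoidsNbhd ((x , y) , _) ws = All (λ w → ¬ Adj w (inj₁ x) × ¬ Adj w (inj₂ y)) ws

  EdgeAsteroidCond : (k : ℕ) → (Fin (suc (k + k)) → Edge) → Set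
  EdgeAsteroidCond k e = ∀ i → Σ (List Vtx) λ ws →
    Linked Adj ws × endsIn (e (i ⊕ k)) ws × endsIn (e (i ⊕ suc k)) ws ×
    avoidsNbhd (e i) ws

  WeakEdgeAsteroid : Set
  WeakEdgeAsteroid = Σ ℕ λ k → 1 ≤ k × Σ (Fin (suc (k + k)) → Edge) λ e →
    EdgeAsteroidCond k e

  EdgeAsteroid : Set
  EdgeAsteroid = Σ ℕ λ k → 1 ≤ k × Σ (Fin (suc (k + k)) → Edge) λ e →
    Injective _≡_ _≡_ e × EdgeAsteroidCond k e

  Cond4 : Set
  Cond4 = ¬ WeakEdgeAsteroid

  Cond5 : Set
  Cond5 = ¬ EdgeAsteroid

  Cond6 : Set
  Cond6 = ¬ Asteroid coIG

module Submission where

open import Defs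
open import Data.Nat using (ℕ; zero; suc; _+_; _*_; _∸_; _<_; _≤_; s≤s; z≤n; parity; _/_; _%_)
import Data.Nat.Properties as ℕ
open import Data.Nat.Properties using (+-suc; +-comm; +-assoc; +-identityʳ; m<m+n; m∸n+n≡m; m∸n≤m; m<n⇒0<n∸m; <⇒≤)
open import Data.Nat.DivMod using (m≡m%n+[m/n]*n; [m+n]%n≡m%n; [m+kn]%n≡m%n; m<n⇒m%n≡m; m%n<n; m%n%n≡m%n; n%n≡0; %-distribˡ-+)
open import Data.Nat.Induction using (<-rec)
open import Data.Nat.Tactic.RingSolver using (solve-∀)
open import Data.Parity.Base using (Parity; 0ℙ; 1ℙ; _⁻¹) renaming (_+_ to _+ℙ_)
open import Data.Parity.Properties using (suc-homo-⁻¹; +-homo-+)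
open import Data.Bool using (Bool; true; false; not)
import Data.Bool.Properties as Bool
open import Data.Fin using (Fin; zero; toℕ; combine; _<?_) renaming (_≤_ to _≤F_; _<_ to _<F_)
import Data.Fin.Properties as Fin
open import Data.Fin.Properties using (_≟_; any?; combine-injective; toℕ-fromℕ<; toℕ-injective; toℕ<n)
open import Data.List using (List; []; _∷_; filter; cartesianProduct; allFin)
import Data.List.Extrema as Extrema
open import Data.List.Membership.Propositional using (_∈_)
import Data.List.Membership.DecPropositional as DecMembership
open import Data.List.Membership.Propositional.Properties using (∈-filter⁺; ∈-cartesianProduct⁺; ∈-allFin)
open import Data.List.Relation.Unary.All using (All; []; _∷_)
import Data.List.Relation.Unary.All as All
open import Data.List.Relation.Unary.All.Properties using (¬Any⇒All¬; all-filter)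
open import Data.List.Relation.Unary.AllPairs using ([]; _∷_)
open import Data.List.Relation.Unary.Any using (here; there)
open import Data.List.Relation.Unary.Linked using (Linked; [-]; _∷_)
open import Data.Product using (Σ; ∃; ∃₂; _×_; _,_; proj₁; proj₂; swap)
open import Data.Product.Properties using (≡-dec)
open import Data.Sum using (_⊎_; inj₁; inj₂)
import Data.Sum as Sum
open import Data.Unit using (tt)
open import Data.Empty using (⊥; ⊥-elim)
open import Axiom.UniquenessOfIdentityProofs using (module Decidable⇒UIP)
open import Function using (_∘_)
open import Function.Bundles using (_⇔_; mk⇔)
open import Function.Definitions using (Injective)
open import Relation.Nullary using (¬_; Dec; yes; no; does)
open import Relation.Nullary.Decidable using (_×-dec_; _⊎-dec_; ¬?; map′; dec-true; decidable-stable)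
open import Relation.Binary.Definitions using (DecidableEquality; tri<; tri≈; tri>)
open import Relation.Binary.PropositionalEquality using (_≡_; _≢_; refl; sym; trans; cong; cong₂; subst; subst₂; module ≡-Reasoning)
open import Relation.Binary.Construct.Closure.ReflexiveTransitive using (Star; ε; _◅_; _◅◅_; reverse; gmap)

-- For a graph H let (u ; w) be the component containing w of the complement of
-- H restricted to the neighbours of u; a walk passes from (u ; w) to (w ; u).
-- An odd closed walk is an arc of H that forces its own reversal, and the
-- conditions are linked through the absence of such walks in H = I(G).
--
-- Without odd closed walks, orienting every forcing class according to its
-- lexicographically least arc is transitive, by the triangle lemma.
--
-- Conversely, a shortest odd closed walk has distinct vertices and so is an
-- asteroid of the complement. Suppose it visits v in two components C₁ ≠ C₂.
-- In H every vertex of C₁ is adjacent to every vertex of C₂. Leaving (v ; C₁)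
-- in either direction, the walk stays adjacent to all of C₂ until it first
-- meets a z whose previous vertex lies in the component of C₂ around z; the
-- arcs between z and C₂ then shorten the walk unless z is its very first step.
-- So all four neighbours of the two visits are such z, and an arc between two
-- of them shortens the walk.

-- Parities and residues

parity-even+ : ∀ a b → parity a ≡ 0ℙ → parity (a + b) ≡ parity b
parity-even+ a b p = trans (+-homo-+ a b) (cong (_+ℙ parity b) p)

parity-odd+ : ∀ a b → parity a ≡ 1ℙ → parity (a + b) ≡ parity b ⁻¹
parity-odd+ a b p = trans (+-homo-+ a b) (cong (_+ℙ parity b) p)

⁻¹-flip : ∀ {p q} → p ⁻¹ ≡ q → p ≡ q ⁻¹
⁻¹-flip {0ℙ} refl = refl
⁻¹-flip {1ℙ} refl = refl

parity-suc : ∀ n → parity (suc n) ≡ parity n ⁻¹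
parity-suc n = ⁻¹-flip (suc-homo-⁻¹ n)

<-by : ∀ {m n} c → m + suc c ≡ n → m < n
<-by {m} c refl = m<m+n m (s≤s z≤n)

parity-odd : ∀ n → parity n ≡ 1ℙ → ∃ λ k → n ≡ suc (k + k)
parity-odd 1 _ = 0 , refl
parity-odd (suc (suc n)) p with k , refl ← parity-odd n p = suc k , cong (λ m → suc (suc m)) (sym (+-suc k k))

toℕ-⊕ : ∀ {N} (i : Fin (suc N)) j → toℕ (i ⊕ j) ≡ (toℕ i + j) % suc N
toℕ-⊕ {N} i j = toℕ-fromℕ< (m%n<n (toℕ i + j) (suc N))

⊕-assoc : ∀ {N} (i : Fin (suc N)) a b → (i ⊕ a) ⊕ b ≡ i ⊕ (a + b)
⊕-assoc {N} i a b = toℕ-injective (begin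
  toℕ ((i ⊕ a) ⊕ b)                               ≡⟨ toℕ-⊕ (i ⊕ a) b ⟩
  (toℕ (i ⊕ a) + b) % M                           ≡⟨ cong (λ z → (z + b) % M) (toℕ-⊕ i a) ⟩
  ((toℕ i + a) % M + b) % M                       ≡⟨ %-distribˡ-+ ((toℕ i + a) % M) b M ⟩
  ((toℕ i + a) % M % M + b % M) % M               ≡⟨ cong (λ z → (z + b % M) % M) (m%n%n≡m%n (toℕ i + a) M) ⟩
  ((toℕ i + a) % M + b % M) % M                   ≡⟨ %-distribˡ-+ (toℕ i + a) b M ⟨
  (toℕ i + a + b) % M                             ≡⟨ cong (_% M) (+-assoc (toℕ i) a b) ⟩
  (toℕ i + (a + b)) % M                           ≡⟨ toℕ-⊕ i (a + b) ⟨
  toℕ (i ⊕ (a + b))                               ∎)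
  where
  open ≡-Reasoning
  M = suc N

⊕-full : ∀ {N} (i : Fin (suc N)) → i ⊕ suc N ≡ i
⊕-full {N} i = toℕ-injective (trans (toℕ-⊕ i (suc N))
  (trans ([m+n]%n≡m%n (toℕ i) (suc N)) (m<n⇒m%n≡m (toℕ<n i))))

⊕1≢ : ∀ {N} → 1 ≤ N → (i : Fin (suc N)) → i ⊕ 1 ≢ i
⊕1≢ {N} 1≤N i eq with ℕ.m≤n⇒m<n∨m≡n (toℕ<n i)
... | inj₁ l = ℕ.1+n≢n (trans (+-comm 1 (toℕ i))
  (trans (sym (m<n⇒m%n≡m (subst (_< suc N) (+-comm 1 (toℕ i)) l))) (trans (sym (toℕ-⊕ i 1)) (cong toℕ eq))))
... | inj₂ e = ℕ.<⇒≢ 1≤N (trans (sym (trans (sym (cong toℕ eq)) (trans (toℕ-⊕ i 1)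
  (trans (cong (_% suc N) (trans (+-comm (toℕ i) 1) e)) (n%n≡0 (suc N)))))) (ℕ.suc-injective e))

-- Adding `k` twice and then 1 is a full turn, so a fixed point of `_⊕ k` would also be fixed by
-- `_⊕ 1`.
⊕k≢ : ∀ {k} → 1 ≤ k → (i : Fin (suc (k + k))) → i ⊕ k ≢ i
⊕k≢ {k} 1≤k i eq = ⊕1≢ (ℕ.≤-trans 1≤k (ℕ.m≤m+n k k)) i (begin
  i ⊕ 1               ≡⟨ cong (_⊕ 1) (trans (cong (_⊕ k) eq) eq) ⟨
  ((i ⊕ k) ⊕ k) ⊕ 1   ≡⟨ cong (_⊕ 1) (⊕-assoc i k k) ⟩
  (i ⊕ (k + k)) ⊕ 1   ≡⟨ ⊕-assoc i (k + k) 1 ⟩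
  i ⊕ (k + k + 1)     ≡⟨ cong (i ⊕_) (+-comm (k + k) 1) ⟩
  i ⊕ suc (k + k)     ≡⟨ ⊕-full i ⟩
  i                   ∎)
  where open ≡-Reasoning

-- Finite decidable relations

module Reachability {A : Set} {R : A → A → Set} (R? : ∀ a b → Dec (R a b))
  (_≟_ : DecidableEquality A) where

  -- Warshall: all inner vertices of the walk are taken from the list.
  Via : List A → A → A → Set
  Via []       a b = a ≡ b ⊎ R a b
  Via (x ∷ xs) a b = Via xs a b ⊎ (Via xs a x × Via xs x b)

  via? : ∀ xs a b → Dec (Via xs a b)
  via? []       a b = (a ≟ b) ⊎-dec R? a b
  via? (x ∷ xs) a b = via? xs a b ⊎-dec (via? xs a x ×-dec via? xs x b)

  via-direct : ∀ xs {a b} → a ≡ b ⊎ R a b → Via xs a b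
  via-direct []       p = p
  via-direct (_ ∷ xs) p = inj₁ (via-direct xs p)

  via-trans : ∀ {xs x a b} → x ∈ xs → Via xs a x → Via xs x b → Via xs a b
  via-trans (here refl) p q = inj₂ (left p , right q)
    where
    left : ∀ {x xs a} → Via (x ∷ xs) a x → Via xs a x
    left (inj₁ p)       = p
    left (inj₂ (p , _)) = p
    right : ∀ {x xs b} → Via (x ∷ xs) x b → Via xs x b
    right (inj₁ q)       = q
    right (inj₂ (_ , q)) = q
  via-trans (there m) (inj₁ p)       (inj₁ q)       = inj₁ (via-trans m p q)
  via-trans (there m) (inj₁ p)       (inj₂ (q , r)) = inj₂ (via-trans m p q , r)
  via-trans (there m) (inj₂ (o , p)) (inj₁ q)       = inj₂ (o , via-trans m p q)
  via-trans (there m) (inj₂ (o , _)) (inj₂ (_ , r)) = inj₂ (o , r)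

  via⇒star : ∀ xs {a b} → Via xs a b → Star R a b
  via⇒star []       (inj₁ refl)    = ε
  via⇒star []       (inj₂ r)       = r ◅ ε
  via⇒star (_ ∷ xs) (inj₁ p)       = via⇒star xs p
  via⇒star (_ ∷ xs) (inj₂ (p , q)) = via⇒star xs p ◅◅ via⇒star xs q

  star⇒via : ∀ {xs} → (∀ a → a ∈ xs) → ∀ {a b} → Star R a b → Via xs a b
  star⇒via {xs} all ε       = via-direct xs (inj₁ refl)
  star⇒via {xs} all (r ◅ s) = via-trans (all _) (via-direct xs (inj₂ r)) (star⇒via all s)

  star? : ∀ {xs} → (∀ a → a ∈ xs) → ∀ a b → Dec (Star R a b)
  star? {xs} all a b = map′ (via⇒star xs) (star⇒via all) (via? xs a b)

true⇒ : ∀ {P : Set} (d : Dec P) → does d ≡ true → P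
true⇒ (yes p) _ = p

module Completion {k : ℕ} {D : Fin k → Fin k → Set} (D? : ∀ a b → Dec (D a b))
  (D-asym : ∀ {a b} → D a b → ¬ D b a) where

  -- Extends `D` to a tournament: the index decides the pairs that `D` leaves open.
  Beats : Fin k → Fin k → Set
  Beats a b = D a b ⊎ (¬ D b a × toℕ a < toℕ b)

  beats? : ∀ a b → Dec (Beats a b)
  beats? a b = D? a b ⊎-dec (¬? (D? b a) ×-dec (a <? b))

  tournament : Fin k → Fin k → Bool
  tournament a b = does (beats? a b)

  ⇒Beats : ∀ {a b} → tournament a b ≡ true → Beats a b
  ⇒Beats {a} {b} = true⇒ (beats? a b)

  D⇒ : ∀ {a b} → tournament a b ≡ true → ¬ D b a
  D⇒ {a} {b} t with ⇒Beats {a} {b} t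
  ... | inj₁ d       = D-asym d
  ... | inj₂ (n , _) = n

  irrefl : ∀ a → ¬ (tournament a a ≡ true)
  irrefl a t with ⇒Beats {a} {a} t
  ... | inj₁ d       = D-asym d d
  ... | inj₂ (_ , l) = ℕ.<-irrefl refl l

  total : ∀ {a b} → a ≢ b → Beats a b ⊎ Beats b a
  total {a} {b} a≢b with D? a b | D? b a | Fin.<-cmp a b
  ... | yes d | _     | _            = inj₁ (inj₁ d)
  ... | no _  | yes d | _            = inj₂ (inj₁ d)
  ... | no _  | no n  | tri< l _ _   = inj₁ (inj₂ (n , l))
  ... | no _  | no _  | tri≈ _ e _   = ⊥-elim (a≢b e)
  ... | no n  | no _  | tri> _ _ g   = inj₂ (inj₂ (n , g))

  asym : ∀ {a b} → Beats a b → ¬ Beats b a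
  asym (inj₁ d)       (inj₁ d')      = D-asym d d'
  asym (inj₁ d)       (inj₂ (n , _)) = n d
  asym (inj₂ (n , _)) (inj₁ d)       = n d
  asym (inj₂ (_ , l)) (inj₂ (_ , g)) = ℕ.<-asym l g

  exactlyOne : ∀ a b → a ≢ b → ExactlyOne (tournament a b ≡ true) (tournament b a ≡ true)
  exactlyOne a b a≢b =
    Sum.map (dec-true (beats? a b)) (dec-true (beats? b a)) (total a≢b) ,
    λ (t , t') → asym (⇒Beats {a} {b} t) (⇒Beats {b} {a} t')

-- Forcing in an abstract graph

module ForcingWalks {V : Set} (H : V → V → Set)
  (H-sym : ∀ {u w} → H u w → H w u) (H-irr : ∀ {u} → ¬ H u u)
  (H? : ∀ u w → Dec (H u w)) where

  CoStep : V → V → V → Set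
  CoStep u w w' = H u w × H u w' × ¬ H w w'

  infix 4 _⊢_≈_
  _⊢_≈_ : V → V → V → Set
  u ⊢ w ≈ w' = Star (CoStep u) w w'

  -- The length counts crossings. Read as an arc, a state is reversed by each `cross`, so the parity
  -- tells whether the last arc or its reversal is forced.
  data Walk : ℕ → V × V → V × V → Set where
    turn  : ∀ {u w w'} → u ⊢ w ≈ w' → Walk 0 (u , w) (u , w')
    cross : ∀ {ℓ u w w' t} → u ⊢ w ≈ w' → H u w' →
            Walk ℓ (w' , u) t → Walk (suc ℓ) (u , w) t

  ≈-sym : ∀ {u w w'} → u ⊢ w ≈ w' → u ⊢ w' ≈ w
  ≈-sym = reverse λ (h , h' , n) → h' , h , λ k → n (H-sym k)

  ≈-nbr : ∀ {u w w'} → H u w → u ⊢ w ≈ w' → H u w'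
  ≈-nbr h ε = h
  ≈-nbr h ((_ , h' , _) ◅ c) = ≈-nbr h' c

  -- A step mentions its base only through adjacency, so it survives at any base adjacent to the
  -- whole component.
  ≈-transfer : ∀ {u b w w'} → (∀ {d} → u ⊢ w ≈ d → H b d) →
               u ⊢ w ≈ w' → b ⊢ w ≈ w'
  ≈-transfer f ε = ε
  ≈-transfer f (s@(_ , _ , n) ◅ c) =
    (f ε , f (s ◅ ε) , n) ◅ ≈-transfer (λ c' → f (s ◅ c')) c

  -- A missing edge between two neighbours of `u` would be a single step joining their components.
  ≉-join : ∀ {u w w'} → H u w → H u w' → ¬ (u ⊢ w ≈ w') → H w w'
  ≉-join h h' ≉ = decidable-stable (H? _ _) λ n → ≉ ((h , h' , n) ◅ ε)

  infixr 5 _++_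
  _++_ : ∀ {a b s t r} → Walk a s t → Walk b t r → Walk (a + b) s r
  turn c ++ turn c' = turn (c ◅◅ c')
  turn c ++ cross c' h w = cross (c ◅◅ c') h w
  cross c h w ++ w' = cross c h (w ++ w')

  snoc : ∀ {a s u w z} → Walk a s (u , w) → H u w → w ⊢ u ≈ z → Walk (suc a) s (w , z)
  snoc (turn c) h c' = cross c h (turn c')
  snoc (cross c k W) h c' = cross c k (snoc W h c')

  rev : ∀ {a s t} → Walk a s t → Walk a t s
  rev (turn c) = turn (≈-sym c)
  -- The reversed crossing arrives at `(u , w')`; `_++₀_` takes its direction back along `c` to `w`.
  rev (cross c h W) = snoc (rev W) (H-sym h) ε ++₀ c
    where
    _++₀_ : ∀ {a s u w w'} → Walk a s (u , w') → u ⊢ w ≈ w' → Walk a s (u , w)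
    turn d ++₀ c = turn (d ◅◅ ≈-sym c)
    cross d h W ++₀ c = cross d h (W ++₀ c)

  -- z is the first vertex at which the walk from (x ; y) to (v ; q) has its previous
  -- vertex in the component of q; b ranges over the component of q around v.
  Side : (v q x y z : V) → ℕ → Set
  Side v q x y z j = (parity j ≡ 1ℙ × (∀ {b} → v ⊢ q ≈ b → b ⊢ z ≈ y)) ⊎
                     (parity j ≡ 0ℙ × (∀ {b} → v ⊢ q ≈ b → b ⊢ z ≈ x))

  -- The walk is cut at `z`, with at least one crossing on either side. `full` and `side` supply the
  -- arcs and turns for shortcuts between `z` and the component of `q`.
  record Stop (v q x y : V) (ℓ : ℕ) : Set where
    field
      j r   : ℕ
      z     : V
      len   : suc j + suc r ≡ ℓ
      front : Walk (suc j) (x , y) (z , q)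
      back  : Walk (suc r) (z , q) (v , q)
      full  : ∀ {b} → v ⊢ q ≈ b → H z b
      side  : Side v q x y z (suc j)

  -- While the current direction is not in the component of `q`, the next vertex is joined to all of
  -- that component, so the invariant `fx` passes on. The double negation is there because
  -- membership in a component is not decided here.
  advance : ∀ {v q x y ℓ} → (∀ {b} → v ⊢ q ≈ b → H x b) → H x y → ¬ (x ⊢ y ≈ q) →
            Walk ℓ (x , y) (v , q) → ¬ ¬ Stop v q x y ℓ
  advance fx hxy bad (turn c) _ = bad c
  advance {v} {q} {x} {y} fx hxy bad (cross {ℓ} {w' = y'} c h W) k = caseW W
    where
    sameq : ∀ {b} → v ⊢ q ≈ b → x ⊢ q ≈ b
    sameq = ≈-transfer fx

    fy : ∀ {b d} → v ⊢ q ≈ b → x ⊢ y ≈ d → H b d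
    fy m c' = ≉-join (fx m) (≈-nbr hxy c') λ e → bad (c' ◅◅ ≈-sym e ◅◅ ≈-sym (sameq m))

    yy' : ∀ {b} → v ⊢ q ≈ b → b ⊢ y' ≈ y
    yy' m = ≈-sym (≈-transfer (fy m) c)

    fy' : ∀ {b} → v ⊢ q ≈ b → H y' b
    fy' m = H-sym (fy m c)

    extend : Stop v q y' x ℓ → Stop v q x y (suc ℓ)
    extend S = record
      { j = suc j ; r = r ; z = z ; len = cong suc len ; front = cross c h front
      ; back = back ; full = full ; side = side' side }
      where
      open Stop S
      side' : Side v q y' x z (suc j) → Side v q x y z (suc (suc j))
      side' (inj₁ (p , f)) = inj₂ (trans (parity-suc (suc j)) (cong _⁻¹ p) , f)
      side' (inj₂ (p , f)) = inj₁ (trans (parity-suc (suc j)) (cong _⁻¹ p) , λ {_} m → f m ◅◅ yy' m)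

    stop : y' ⊢ x ≈ q → Walk ℓ (y' , x) (v , q) → ⊥
    -- The walk would end at `y' = v`, putting `x` in the component of `q` around `v`; then `fx`
    -- gives a loop at `x`.
    stop g (turn c') = H-irr (fx (≈-sym c'))
    stop g W@(cross {r} _ _ _) = k record
      { j = 0 ; r = r ; z = y' ; len = refl ; front = cross c h (turn g)
      ; back = turn (≈-sym g) ++ W ; full = fy' ; side = inj₁ (refl , yy') }

    caseW : Walk ℓ (y' , x) (v , q) → ⊥
    caseW W = advance fy' (H-sym h) (λ g → stop g W) W (λ S → k (extend S))

  -- Shortcuts in a shortest odd closed walk.

  Shortest : ℕ → Set
  Shortest n = ∀ {L s} → Walk L s s → parity L ≡ 1ℙ → ¬ (L < n)

  Immediate : (v q x y : V) (ℓ : ℕ) → Set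
  Immediate v q x y ℓ = Σ (Stop v q x y ℓ) λ S → Stop.j S ≡ 0

  immediate : ∀ {v p q d e} → Shortest (d + e) → parity d ≡ 1ℙ → parity e ≡ 0ℙ →
    H v p → H v q → ¬ (v ⊢ p ≈ q) →
    Walk d (v , p) (v , q) → Walk e (v , p) (v , q) →
    ¬ ¬ (Immediate v q v p d × Immediate v q v p e)
  immediate {v} {p} {q} {d} {e} short od ev hp hq ≉ W₁ W₂ k =
    advance (≈-nbr hq) hp ≉ W₁ λ S₁ → advance (≈-nbr hq) hp ≉ W₂ λ S₂ → both S₁ S₂
    where
    both : Stop v q v p d → Stop v q v p e → ⊥
    both S₁@(record { j = j₁ ; r = r₁ ; z = z₁ ; len = refl ; front = front₁ ; back = back₁ ; full = full₁ ; side = side₁ })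
         S₂@(record { j = j₂ ; r = r₂ ; z = z₂ ; len = refl ; front = front₂ ; back = back₂ ; full = full₂ ; side = side₂ }) = go side₁ side₂
      where
      len₁ : ∀ j R S → 2 + R + suc (j + S) ≡ (suc (suc j) + R) + suc S
      len₁ = solve-∀
      len₂ : ∀ a b R S → 2 + (R + S) + suc (a + b) ≡ (suc (suc a) + R) + (suc b + S)
      len₂ = solve-∀
      len₃ : ∀ b R S → 2 + (R + S) + suc b ≡ (1 + R) + (suc (suc b) + S)
      len₃ = solve-∀
      go : Side v q v p z₁ (suc j₁) → Side v q v p z₂ (suc j₂) → ⊥
      -- Even stop on `W₁`: the steps from `v` to `q` to `z₁` replace the front part, and `back₁`
      -- closes the walk without `W₂`.
      go (inj₂ (p₁ , f₁)) _ = short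
        (cross ε hq (cross (≈-sym (f₁ ε)) (H-sym (full₁ ε)) (turn ε)) ++ back₁)
        (trans (sym (parity-even+ (suc j₁) (suc r₁) p₁)) od)
        (bound j₁ p₁)
        where
        bound : ∀ j₁ → parity (suc j₁) ≡ 0ℙ → 2 + suc r₁ < (suc j₁ + suc r₁) + (suc j₂ + suc r₂)
        bound (suc j) _ = <-by (j + (j₂ + suc r₂)) (len₁ j (suc r₁) (j₂ + suc r₂))
      -- Even stop on `W₂`: the reversed `W₁` is entered from `z₂` instead of `v`, and `front₂`
      -- closes it, so `back₂` is saved.
      go (inj₁ _) (inj₂ (p₂ , f₂)) = chord (rev W₁) refl
        where
        chord : ∀ {d'} → Walk d' (v , q) (v , p) → d' ≡ d → ⊥
        chord (turn c) _ = ≉ (≈-sym c)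
        chord (cross {ℓ} c h R) eq = short
          (cross (≈-transfer full₂ c) (full₂ c) (turn (f₂ c)) ++ (R ++ front₂))
          (trans (cong parity leneq) (trans (trans (cong parity (+-comm d (suc j₂))) (parity-even+ (suc j₂) d p₂)) od))
          (<-by r₂ (trans (cong (_+ suc r₂) leneq) (+-assoc d (suc j₂) (suc r₂))))
          where
          leneq : suc (ℓ + suc j₂) ≡ d + suc j₂
          leneq = cong (_+ suc j₂) eq
      go (inj₁ (p₁ , f₁)) (inj₁ (p₂ , f₂)) = split j₁ j₂ refl refl
        where
        evr₁ : parity (suc r₁) ≡ 0ℙ
        evr₁ = ⁻¹-flip (trans (sym (parity-odd+ (suc j₁) (suc r₁) p₁)) od)
        odr₂ : parity (suc r₂) ≡ 1ℙ
        odr₂ = ⁻¹-flip (trans (sym (parity-odd+ (suc j₂) (suc r₂) p₂)) ev)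
        -- Two odd stops: the steps from `z₂` to `q` to `z₁` replace both front parts. This saves
        -- length unless both stops occur at the first crossing.
        closed : 2 + (suc r₁ + suc r₂) < (suc j₁ + suc r₁) + (suc j₂ + suc r₂) → ⊥
        closed = short
          (cross ε (full₂ ε) (cross (f₂ ε ◅◅ ≈-sym (f₁ ε)) (H-sym (full₁ ε)) (turn ε)) ++ (back₁ ++ rev back₂))
          (trans (parity-even+ (suc r₁) (suc r₂) evr₁) odr₂)
        split : ∀ a b → j₁ ≡ a → j₂ ≡ b → ⊥
        split zero zero e₁ e₂ = k ((S₁ , e₁) , (S₂ , e₂))
        split (suc a) b refl refl = closed (<-by (a + b) (len₂ a b (suc r₁) (suc r₂)))
        split zero (suc b) refl refl = closed (<-by b (len₃ b (suc r₁) (suc r₂)))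

  -- The first steps `a` of `W₁` and `b` of the reversed `W₂` are both stops, hence adjacent.
  -- Inserting `a` between `v` and `b` in the reversed `W₂` makes its length odd and still less than
  -- `d + e`.
  no-revisit : ∀ {v p q d e} → Shortest (d + e) → parity d ≡ 1ℙ → parity e ≡ 0ℙ → 0 < e →
    H v p → H v q → Walk d (v , p) (v , q) → Walk e (v , p) (v , q) → ⊥
  no-revisit {v} {p} {q} {d} {suc e} short od ev _ hp hq W₁ W₂ =
    immediate short od ev hp hq ≉ W₁ W₂ λ (I₁ , _) →
    immediate short od ev hq hp (λ c → ≉ (≈-sym c)) (rev W₁) (rev W₂) λ (_ , I₂) →
    chord I₁ I₂
    where
    -- If the directions agreed, `W₁` alone would close up to a shorter odd walk.
    ≉ : ¬ (v ⊢ p ≈ q)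
    ≉ c = short (W₁ ++ turn (≈-sym c)) (trans (cong parity (+-comm d 0)) od) (<-by e (cong (_+ suc e) (+-comm d 0)))

    len₄ : ∀ r S → 2 + S + suc r ≡ suc (suc r) + suc S
    len₄ = solve-∀

    chord : Immediate v q v p d → Immediate v p v q (suc e) → ⊥
    chord (record { j = zero ; r = r₁ ; z = a ; len = refl ; front = cross c₁ h₁ (turn g₁) ; full = full₁ } , refl)
          (record { j = zero ; r = r₂ ; z = b ; len = refl ; front = cross c₂ h₂ (turn g₂) ; back = back₂ ; full = full₂ } , refl) =
      short (cross c₁ h₁ (cross (g₁ ◅◅ ≈-transfer full₁ c₂) (full₁ c₂) (turn (≈-sym (≈-transfer full₂ c₁)))) ++ back₂)
        (trans (parity-suc (suc e)) (cong _⁻¹ ev))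
        (<-by r₁ (len₄ r₁ (suc r₂)))

  -- Closed walks as periodic sequences.

  record Cycle (n : ℕ) : Set where
    field
      at       : ℕ → V
      periodic : ∀ i → at (n + i) ≡ at i
      adjacent : ∀ i → H (at i) (at (suc i))
      turning  : ∀ i → at (suc i) ⊢ at i ≈ at (suc (suc i))

  module Unroll {ℓ x y y'} (c₀ : x ⊢ y ≈ y') (h₀ : H x y') (R₀ : Walk ℓ (y' , x) (x , y)) where
    State : Set
    State = Σ ℕ λ ℓ → Σ (V × V) λ s → Walk ℓ s (x , y)

    base dir : State → V
    base (_ , (b , _) , _) = b
    dir  (_ , (_ , d) , _) = d

    next : State → State
    -- The final turn merges with the first one, so restarting already performs the first crossing.
    next (_ , _ , turn _)      = _ , _ , R₀
    next (_ , _ , cross _ _ R) = _ , _ , R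

    next-adjacent : ∀ X → H (base X) (base (next X))
    next-adjacent (_ , _ , turn _)      = h₀
    next-adjacent (_ , _ , cross _ h _) = h

    next-turning : ∀ X → base X ⊢ dir X ≈ base (next X)
    next-turning (_ , _ , turn c)      = c ◅◅ c₀
    next-turning (_ , _ , cross c _ _) = c

    next-dir : ∀ X → dir (next X) ≡ base X
    next-dir (_ , _ , turn _)      = refl
    next-dir (_ , _ , cross _ _ _) = refl

    state : ℕ → State
    state zero    = _ , _ , cross c₀ h₀ R₀
    state (suc i) = next (state i)

    state-end : ∀ i {a s} (X : Walk a s (x , y)) → state i ≡ (a , s , X) →
                base (state (a + i)) ≡ x × state (suc (a + i)) ≡ state 1
    state-end i (turn c) eq = cong base eq , cong next eq
    state-end i (cross {a} c h R) eq =
      subst (λ j → base (state j) ≡ x × state (suc j) ≡ state 1) (+-suc a i)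
        (state-end (suc i) R (cong next eq))

    -- The period starts at index 1: state `suc ℓ` is the final `turn` and state 0 the initial
    -- `cross`, but both have base `x`.
    state-periodic : ∀ i → state (suc (suc ℓ + i)) ≡ state (suc i)
    state-periodic zero    = proj₂ (state-end 0 _ refl)
    state-periodic (suc i) rewrite +-suc ℓ i = cong next (state-periodic i)

    periodic : ∀ i → base (state (suc ℓ + i)) ≡ base (state i)
    periodic zero    = proj₁ (state-end 0 _ refl)
    periodic (suc i) rewrite +-suc ℓ i = cong base (state-periodic i)

    cycle : Cycle (suc ℓ)
    cycle = record
      { at       = λ i → base (state i)
      ; periodic = periodic
      ; adjacent = λ i → next-adjacent (state i)
      ; turning  = λ i → subst (base (state (suc i)) ⊢_≈ base (state (suc (suc i)))) (next-dir (state i)) (next-turning (state (suc i)))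
      }

  module _ {n : ℕ} (C : Cycle n) where
    open Cycle C

    segment : ∀ i ℓ → Walk ℓ (at i , at (suc i)) (at (ℓ + i) , at (suc (ℓ + i)))
    segment i zero    = turn ε
    segment i (suc ℓ) = subst (λ j → Walk (suc ℓ) (at i , at (suc i)) (at j , at (suc j))) (+-suc ℓ i)
      (cross ε (adjacent i) (turn (turning i) ++ segment (suc i) ℓ))

    -- A repeated vertex cuts the cycle into two walks between the outgoing directions `p` and `q`.
    -- As `n` is odd, exactly one of them has odd length; it is the first walk given to
    -- `no-revisit`.
    at-distinct : Shortest n → parity n ≡ 1ℙ → ∀ {a b} → a < b → b < n → at a ≢ at b
    at-distinct short odd {a} {b} a<b b<n eq = go (parity d) refl
      where
      d e : ℕ
      d = b ∸ a
      e = n ∸ d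
      d+a≡b : d + a ≡ b
      d+a≡b = m∸n+n≡m (<⇒≤ a<b)
      d<n : d < n
      d<n = ℕ.≤-<-trans (m∸n≤m b a) b<n
      e+d≡n : e + d ≡ n
      e+d≡n = m∸n+n≡m (<⇒≤ d<n)
      v p q : V
      v = at a
      p = at (suc a)
      q = at (suc (d + a))
      v≡ : at (d + a) ≡ v
      v≡ = trans (cong at d+a≡b) (sym eq)
      W₁ : Walk d (v , p) (v , q)
      W₁ = subst (λ z → Walk d (v , p) (z , q)) v≡ (segment a d)
      wrap : e + (d + a) ≡ n + a
      wrap = trans (sym (+-assoc e d a)) (cong (_+ a) e+d≡n)
      W₂ : Walk e (v , q) (v , p)
      W₂ = subst₂ (Walk e) (cong (_, q) v≡)
        (cong₂ _,_ (trans (cong at wrap) (periodic a))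
                   (trans (cong at (trans (cong suc wrap) (sym (+-suc n a)))) (periodic (suc a))))
        (segment (d + a) e)
      hq : H v q
      hq = subst (λ z → H z q) v≡ (adjacent (d + a))
      go : ∀ π → parity d ≡ π → ⊥
      go 1ℙ od = no-revisit (subst Shortest (sym (trans (+-comm d e) e+d≡n)) short) od
        (⁻¹-flip (trans (sym (parity-odd+ d e od)) (trans (cong parity (trans (+-comm d e) e+d≡n)) odd)))
        (m<n⇒0<n∸m d<n) (adjacent a) hq W₁ (rev W₂)
      go 0ℙ ev = no-revisit (subst Shortest (sym e+d≡n) short)
        (trans (sym (parity-even+ d e ev)) (trans (cong parity (trans (+-comm d e) e+d≡n)) odd))
        ev (m<n⇒0<n∸m a<b) (adjacent a) hq (rev W₂) W₁

    at-injective : Shortest n → parity n ≡ 1ℙ → ∀ {a b} → a < n → b < n → at a ≡ at b → a ≡ b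
    at-injective short odd {a} {b} a<n b<n eq with ℕ.<-cmp a b
    ... | tri< a<b _ _ = ⊥-elim (at-distinct short odd a<b b<n eq)
    ... | tri≈ _ a≡b _ = a≡b
    ... | tri> _ _ b<a = ⊥-elim (at-distinct short odd b<a a<n (sym eq))

  -- Asteroids from shortest odd closed walks.

  Complement : V → V → Set
  Complement u w = u ≢ w × ¬ H u w

  module _ (_≟_ : DecidableEquality V) where
    open DecMembership _≟_ using (_∈?_)

    PathWithin : (V → Set) → V → V → Set
    PathWithin P a b = Σ (PathFromTo Complement a b) λ p → All P (pathVerts p)

    suffix : ∀ {P a b x} (p : PathFromTo Complement a b) → All P (pathVerts p) →
             x ∈ pathVerts p → PathWithin P x b
    suffix p all (here refl) = p , all
    suffix (path (_ ∷ r) (_ ∷ lk) ends (_ ∷ uq)) (_ ∷ all) (there m) =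
      suffix (path r lk ends uq) all m

    ≈⇒path : ∀ {u w w'} → H u w → u ⊢ w ≈ w' → PathWithin (H u) w w'
    ≈⇒path h ε = path [] [-] refl ([] ∷ []) , h ∷ []
    ≈⇒path {w = w} h ((_ , h' , n) ◅ c) with ≈⇒path h' c
    ... | p@(path r lk ends uq) , all with w ∈? pathVerts p
    -- A repeated vertex restarts the path at its occurrence, which cuts off the loop.
    ...   | yes w∈ = suffix p all w∈
    ...   | no w∉  = path (_ ∷ r) (((λ e → w∉ (here e)) , n) ∷ lk) ends (¬Any⇒All¬ _ w∉ ∷ uq) , h ∷ all

    module _ {k : ℕ} (C : Cycle (suc (k + k))) (short : Shortest (suc (k + k)))
             (odd : parity (suc (k + k)) ≡ 1ℙ) (1≤k : 1 ≤ k) where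
      open Cycle C

      n : ℕ
      n = suc (k + k)

      at-* : ∀ c i → at (i + c * n) ≡ at i
      at-* zero    i = cong at (+-identityʳ i)
      at-* (suc c) i = trans (cong at (lemma c i n)) (trans (periodic (i + c * n)) (at-* c i))
        where
        lemma : ∀ c i n → i + suc c * n ≡ n + (i + c * n)
        lemma = solve-∀

      at-% : ∀ m → at (2 * (m % n)) ≡ at (2 * m)
      at-% m = begin
        at (2 * (m % n))                          ≡⟨ at-* (2 * (m / n)) (2 * (m % n)) ⟨
        at (2 * (m % n) + 2 * (m / n) * n)        ≡⟨ cong at (lemma (m % n) (m / n) n) ⟩
        at (2 * (m % n + m / n * n))              ≡⟨ cong (λ z → at (2 * z)) (m≡m%n+[m/n]*n m n) ⟨
        at (2 * m)                                ∎
        where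
        open ≡-Reasoning
        lemma : ∀ r c n → 2 * r + 2 * c * n ≡ 2 * (r + c * n)
        lemma = solve-∀

      -- Stepping twice along the cycle makes v (i + k) and v (i + k + 1) the
      -- two neighbours of v i on the cycle, as 2k + 1 = 0.
      v : Fin n → V
      v i = at (2 * toℕ i)

      v-⊕ : ∀ i j → v (i ⊕ j) ≡ at (2 * (toℕ i + j))
      v-⊕ i j = trans (cong (λ z → at (2 * z)) (toℕ-fromℕ< (m%n<n (toℕ i + j) n))) (at-% (toℕ i + j))

      v-injective : Injective _≡_ _≡_ v
      v-injective {i} {j} eq = toℕ-injective (begin
        toℕ i                       ≡⟨ halve i ⟨
        (suc k * (2 * toℕ i % n)) % n ≡⟨ cong (λ z → (suc k * z) % n) reduced ⟩
        (suc k * (2 * toℕ j % n)) % n ≡⟨ halve j ⟩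
        toℕ j                       ∎)
        where
        open ≡-Reasoning
        at-reduce : ∀ m → at (m % n) ≡ at m
        at-reduce m = trans (sym (at-* (m / n) (m % n))) (cong at (sym (m≡m%n+[m/n]*n m n)))
        reduced : 2 * toℕ i % n ≡ 2 * toℕ j % n
        reduced = at-injective C short odd (m%n<n (2 * toℕ i) n) (m%n<n (2 * toℕ j) n)
          (trans (at-reduce (2 * toℕ i)) (trans eq (sym (at-reduce (2 * toℕ j)))))
        -- `suc k` is the inverse of 2 modulo `2k + 1`.
        halve : ∀ i → (suc k * (2 * toℕ i % n)) % n ≡ toℕ i
        halve i = begin
          (suc k * (2 * toℕ i % n)) % n ≡⟨ [m+kn]%n≡m%n (suc k * (2 * toℕ i % n)) (suc k * (2 * toℕ i / n)) n ⟨
          (suc k * (2 * toℕ i % n) + suc k * (2 * toℕ i / n) * n) % n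
            ≡⟨ cong (_% n) (l₁ (suc k) (2 * toℕ i % n) (2 * toℕ i / n) n) ⟩
          (suc k * (2 * toℕ i % n + 2 * toℕ i / n * n)) % n
            ≡⟨ cong (λ z → (suc k * z) % n) (m≡m%n+[m/n]*n (2 * toℕ i) n) ⟨
          (suc k * (2 * toℕ i)) % n  ≡⟨ cong (_% n) (l₂ k (toℕ i)) ⟩
          (toℕ i + toℕ i * n) % n    ≡⟨ [m+kn]%n≡m%n (toℕ i) (toℕ i) n ⟩
          toℕ i % n                  ≡⟨ m<n⇒m%n≡m (toℕ<n i) ⟩
          toℕ i                      ∎
          where
          l₁ : ∀ a r c n → a * r + a * c * n ≡ a * (r + c * n)
          l₁ = solve-∀
          l₂ : ∀ k i → suc k * (2 * i) ≡ i + i * suc (k + k)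
          l₂ = solve-∀

      link : ∀ i → v i ⊢ v (i ⊕ k) ≈ v (i ⊕ suc k) × H (v i) (v (i ⊕ k))
      link i rewrite v-⊕ i k | v-⊕ i (suc k) =
        subst₂ (λ x y → x ⊢ at m ≈ y × H x (at m)) mid (cong at (l₂ (toℕ i) k))
          (turning m , H-sym (adjacent m))
        where
        m : ℕ
        m = 2 * (toℕ i + k)
        l₁ : ∀ i k → suc (2 * (i + k)) ≡ suc (k + k) + 2 * i
        l₁ = solve-∀
        l₂ : ∀ i k → suc (suc (2 * (i + k))) ≡ 2 * (i + suc k)
        l₂ = solve-∀
        mid : at (suc m) ≡ v i
        mid = trans (cong at (l₁ (toℕ i) k)) (periodic (2 * toℕ i))

      asteroid : Asteroid Complement
      asteroid = k , 1≤k , v , v-injective , λ i →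
        let c , h = link i
            p , all = ≈⇒path h c
        in p , All.map (λ h (_ , n) → n h) all

    -- By strong induction on the length all shorter odd closed walks are excluded, so the present
    -- one is shortest; length 1 would be a loop.
    no-odd-closed-walk : ¬ Asteroid Complement → ∀ {L s} → Walk L s s → parity L ≢ 1ℙ
    no-odd-closed-walk ¬ast {L} W odd =
      <-rec (λ L → ∀ {s} → Walk L s s → parity L ≢ 1ℙ) step L W odd
      where
      step : ∀ L → (∀ {l} → l < L → ∀ {s} → Walk l s s → parity l ≢ 1ℙ) →
             ∀ {s} → Walk L s s → parity L ≢ 1ℙ
      step L rec (cross c h R) odd with parity-odd L odd | Unroll.cycle c h R
      ... | zero , refl | C = H-irr (subst (H (Cycle.at C 0)) (Cycle.periodic C 0) (Cycle.adjacent C 0))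
      ... | suc k , refl | C = ¬ast (asteroid C (λ W odd l<L → rec l<L W odd) odd (s≤s z≤n))

  -- A transitive orientation from the forcing classes.

  module Orientation (_≟_ : DecidableEquality V) (elems : List V) (complete : ∀ u → u ∈ elems)
    {N : ℕ} (index : V → Fin N) (index-injective : Injective _≡_ _≡_ index)
    (no-odd : ∀ {L s} → Walk L s s → parity L ≢ 1ℙ) where

    Arc : Set
    Arc = V × V

    -- Gallai's relation Γ.
    Forces : Arc → Arc → Set
    Forces (a , b) (c , d) = (a ≡ c × H a b × H c d × ¬ H b d) ⊎ (b ≡ d × H a b × H c d × ¬ H a c)

    infix 4 _~_ _~?_
    _~_ : Arc → Arc → Set
    _~_ = Star Forces

    forces? : ∀ p q → Dec (Forces p q)
    forces? (a , b) (c , d) =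
      ((a ≟ c) ×-dec H? a b ×-dec H? c d ×-dec ¬? (H? b d)) ⊎-dec
      ((b ≟ d) ×-dec H? a b ×-dec H? c d ×-dec ¬? (H? a c))

    forces-sym : ∀ {p q} → Forces p q → Forces q p
    forces-sym (inj₁ (refl , h , h' , n)) = inj₁ (refl , h' , h , λ k → n (H-sym k))
    forces-sym (inj₂ (refl , h , h' , n)) = inj₂ (refl , h' , h , λ k → n (H-sym k))

    forces-swap : ∀ {p q} → Forces p q → Forces (swap p) (swap q)
    forces-swap (inj₁ (e , h , h' , n)) = inj₂ (e , H-sym h , H-sym h' , n)
    forces-swap (inj₂ (e , h , h' , n)) = inj₁ (e , H-sym h , H-sym h' , n)

    ~-sym : ∀ {p q} → p ~ q → q ~ p
    ~-sym = reverse forces-sym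

    ~-swap : ∀ {p q} → p ~ q → swap p ~ swap q
    ~-swap = gmap swap forces-swap

    arcs : List Arc
    arcs = cartesianProduct elems elems

    ∈-arcs : ∀ p → p ∈ arcs
    ∈-arcs (u , w) = ∈-cartesianProduct⁺ (complete u) (complete w)

    _~?_ : ∀ p q → Dec (p ~ q)
    _~?_ = Reachability.star? forces? (≡-dec _≟_ _≟_) ∈-arcs

    ~-edge : ∀ {a b c d} → H a b → (a , b) ~ (c , d) → H c d
    ~-edge h ε = h
    ~-edge _ (inj₁ (_ , _ , h , _) ◅ s) = ~-edge h s
    ~-edge _ (inj₂ (_ , _ , h , _) ◅ s) = ~-edge h s

    -- Forcing with a common source is a turn; with a common target the walk crosses, turns there
    -- and crosses back. Both lengths are even.
    ~⇒walk : ∀ {p q} → p ~ q → ∃ λ L → parity L ≡ 0ℙ × Walk L p q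
    ~⇒walk ε = 0 , refl , turn ε
    ~⇒walk (inj₁ (refl , h , h' , n) ◅ s) with L , ev , W ← ~⇒walk s =
      L , ev , turn ((h , h' , n) ◅ ε) ++ W
    ~⇒walk (inj₂ (refl , h , h' , n) ◅ s) with L , ev , W ← ~⇒walk s =
      2 + L , ev , cross ε h (cross ((H-sym h , H-sym h' , n) ◅ ε) (H-sym h') W)

    -- One crossing followed by the reversed even walk would be an odd closed walk.
    ≁-swap : ∀ {a b} → H a b → ¬ ((a , b) ~ (b , a))
    ≁-swap h s with L , ev , W ← ~⇒walk s =
      no-odd (cross ε h (turn ε) ++ rev W) (trans (parity-suc L) (cong _⁻¹ ev))

    -- The triangle lemma of Gallai and Golumbic.
    triangle : ∀ {a b c b' c'} → H a b → H a c → H b c →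
      ¬ ((b , c) ~ (b , a)) → ¬ ((b , c) ~ (a , c)) → (b , c) ~ (b' , c') →
      (a , b) ~ (a , b') × (a , c) ~ (a , c')
    triangle ab ac bc n₁ n₂ ε = ε , ε
    triangle {a} {b} {c} ab ac bc n₁ n₂ (s@(inj₁ (refl , _ , bd , n)) ◅ r) =
      let e₁ , e₂ = triangle ab ad bd (λ t → n₁ (s ◅ t)) (λ t → n₂ (s ◅ t ◅◅ f ◅ ε)) r
      in e₁ , forces-sym f ◅ e₂
      where
      -- Were `a` not adjacent to the new head of the arc, that arc would force `(b , a)`, against
      -- `n₁`.
      ad : H a _
      ad = decidable-stable (H? _ _) λ k →
        n₁ (s ◅ inj₁ (refl , bd , H-sym ab , λ h → k (H-sym h)) ◅ ε)
      f : Forces (a , _) (a , c)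
      f = inj₁ (refl , ad , ac , λ h → n (H-sym h))
    triangle {a} {b} {c} ab ac bc n₁ n₂ (s@(inj₂ (refl , _ , dc , n)) ◅ r) =
      let e₁ , e₂ = triangle ad ac dc (λ t → n₁ (s ◅ t ◅◅ f ◅ ε)) (λ t → n₂ (s ◅ t)) r
      in inj₁ (refl , ab , ad , n) ◅ e₁ , e₂
      where
      ad : H a _
      ad = decidable-stable (H? _ _) λ k →
        n₂ (s ◅ inj₂ (refl , dc , ac , λ h → k (H-sym h)) ◅ ε)
      f : Forces (_ , a) (b , a)
      f = inj₂ (refl , H-sym ad , H-sym ab , λ h → n (H-sym h))

    -- The lexicographic order of arcs, sources compared first.
    code : Arc → Fin (N * N)
    code (a , b) = combine (index a) (index b)

    code-injective : ∀ {p q} → code p ≡ code q → p ≡ q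
    code-injective {a , b} {c , d} e
      with eq₁ , eq₂ ← Fin.combine-injective (index a) (index b) (index c) (index d) e =
      cong₂ _,_ (index-injective eq₁) (index-injective eq₂)

    code-≤ : ∀ {a b c d} → code (a , b) ≤F code (c , d) → index a ≤F index c
    code-≤ {a} {b} {c} {d} le with Fin.<-cmp (index a) (index c)
    ... | tri< a<c _ _ = ℕ.<⇒≤ a<c
    ... | tri≈ _ a≡c _ = Fin.≤-reflexive a≡c
    ... | tri> _ _ c<a = ⊥-elim (ℕ.<⇒≱ (Fin.combine-monoˡ-< (index d) (index b) c<a) le)

    open Extrema (Fin.≤-totalOrder (N * N)) using (argmin; argmin-all; f[argmin]≤f[xs])

    least : Arc → Arc
    -- The default `p` lies in its own class, so the minimum does too.
    least p = argmin code p (filter (p ~?_) arcs)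

    ~-least : ∀ p → p ~ least p
    ~-least p = argmin-all code {⊤ = p} {P = p ~_} ε (all-filter (p ~?_) arcs)

    least-≤ : ∀ {p q} → p ~ q → code (least p) ≤F code q
    least-≤ {p} {q} s =
      All.lookup (f[argmin]≤f[xs] {f = code} p (filter (p ~?_) arcs)) (∈-filter⁺ (p ~?_) (∈-arcs q) s)

    rank : Arc → Fin (N * N)
    rank p = code (least p)

    rank-cong : ∀ {p q} → p ~ q → rank p ≡ rank q
    rank-cong {p} {q} s = Fin.≤-antisym (least-≤ (s ◅◅ ~-least q)) (least-≤ (~-sym s ◅◅ ~-least p))

    rank-swap-≢ : ∀ {a b} → H a b → rank (a , b) ≢ rank (b , a)
    rank-swap-≢ {a} {b} h e = ≁-swap h
      (subst ((a , b) ~_) (code-injective e) (~-least (a , b)) ◅◅ ~-sym (~-least (b , a)))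

    -- The choice depends only on the classes of the two arcs, so it is invariant under forcing.
    _⇀_ : V → V → Set
    a ⇀ b = H a b × rank (a , b) <F rank (b , a)

    _⇀?_ : ∀ a b → Dec (a ⇀ b)
    a ⇀? b = H? a b ×-dec (rank (a , b) Fin.<? rank (b , a))

    ⇀-asym : ∀ {a b} → a ⇀ b → ¬ b ⇀ a
    ⇀-asym (_ , l) (_ , l') = Fin.<-asym l l'

    ⇀-total : ∀ {a b} → H a b → a ⇀ b ⊎ b ⇀ a
    ⇀-total {a} {b} h with Fin.<-cmp (rank (a , b)) (rank (b , a))
    ... | tri< l _ _ = inj₁ (h , l)
    ... | tri≈ _ e _ = ⊥-elim (rank-swap-≢ h e)
    ... | tri> _ _ g = inj₂ (H-sym h , g)

    ⇀-resp : ∀ {a b c d} → (a , b) ~ (c , d) → a ⇀ b → c ⇀ d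
    ⇀-resp s (h , l) = ~-edge h s , subst₂ _<F_ (rank-cong s) (rank-cong (~-swap s)) l

    ⇀-triangle : ∀ {a b c b' c'} → a ⇀ b → b ⇀ c → c ⇀ a → (b , c) ~ (b' , c') →
                 (a , b) ~ (a , b') × (a , c) ~ (a , c')
    ⇀-triangle ab bc ca = triangle (proj₁ ab) (H-sym (proj₁ ca)) (proj₁ bc)
      (λ s → ⇀-asym ab (⇀-resp s bc)) (λ s → ⇀-asym ca (⇀-resp s bc))

    -- With (i , j) the least arc of the class of (b , c), the least arc of the
    -- class of (a , b) also starts at i, which is incompatible with the
    -- triangle lemma for the triangle a, i, j seen from j.
    acyclic-from-least : ∀ {a b c} → a ⇀ b → b ⇀ c → c ⇀ a → rank (b , c) ≤F rank (a , b) → ⊥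
    acyclic-from-least {a} {b} {c} ab bc ca le = conclude same-source
      where
      i j p q : V
      i = proj₁ (least (b , c))
      j = proj₂ (least (b , c))
      p = proj₁ (least (a , b))
      q = proj₂ (least (a , b))
      bc~ij : (b , c) ~ (i , j)
      bc~ij = ~-least (b , c)
      ab~ai : (a , b) ~ (a , i)
      ab~ai = proj₁ (⇀-triangle ab bc ca bc~ij)
      ac~aj : (a , c) ~ (a , j)
      ac~aj = proj₂ (⇀-triangle ab bc ca bc~ij)
      ij : i ⇀ j
      ij = ⇀-resp bc~ij bc
      ai : a ⇀ i
      ai = ⇀-resp ab~ai ab
      ja : j ⇀ a
      ja = ⇀-resp (~-swap ac~aj) ca
      ab~pq : (a , b) ~ (p , q)
      ab~pq = ~-least (a , b)
      -- `(p , q)` precedes `(i , a)`, which lies in the class of `(b , a)`, and by `le` it does not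
      -- precede `(i , j)`; comparing sources leaves only `i`.
      same-source : p ≡ i
      same-source = index-injective (Fin.≤-antisym
        (code-≤ {p} {q} {i} {a} (ℕ.<⇒≤ (ℕ.<-≤-trans (proj₂ ab) (least-≤ (~-swap ab~ai)))))
        (code-≤ {i} {j} {p} {q} le))
      conclude : p ≡ i → ⊥
      -- `(a , i)` is equivalent to `(i , q)`, so in the triangle `j`, `a`, `i` the arc `(j , a)` is
      -- equivalent to `(j , i)`, against `ij`.
      conclude p≡i = ⇀-asym ij (⇀-resp
        (proj₁ (⇀-triangle ja ai ij (~-sym ab~ai ◅◅ subst (λ x → (a , b) ~ (x , q)) p≡i ab~pq))) ja)

    acyclic : ∀ {a b c} → a ⇀ b → b ⇀ c → c ⇀ a → ⊥
    -- The ranks cannot strictly increase at all three corners, so some rotation of the triangle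
    -- meets the hypothesis of `acyclic-from-least`.
    acyclic {a} {b} {c} ab bc ca
      with Fin.≤-total (rank (b , c)) (rank (a , b)) | Fin.≤-total (rank (c , a)) (rank (b , c))
         | Fin.≤-total (rank (a , b)) (rank (c , a))
    ... | inj₁ le | _ | _ = acyclic-from-least ab bc ca le
    ... | _ | inj₁ le | _ = acyclic-from-least bc ca ab le
    ... | _ | _ | inj₁ le = acyclic-from-least ca ab bc le
    ... | inj₂ l₁ | inj₂ l₂ | inj₂ l₃ = acyclic-from-least ab bc ca (Fin.≤-trans l₂ l₃)

    ⇀-trans : ∀ {a b c} → a ⇀ b → b ⇀ c → a ⇀ c
    ⇀-trans {a} {b} {c} ab bc with H? a c
    -- Without the edge `ac`, the arc `(a , b)` forces `(c , b)`.
    ... | no n = ⊥-elim (⇀-asym bc (⇀-resp (inj₂ (refl , proj₁ ab , H-sym (proj₁ bc) , n) ◅ ε) ab))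
    ... | yes h with ⇀-total h
    ...   | inj₁ ac = ac
    ...   | inj₂ ca = ⊥-elim (acyclic ab bc ca)

    comparability : IsComparabilityGraph H
    comparability = (λ a b → does (a ⇀? b)) ,
      (λ a b h → Sum.map (from-⇀) (from-⇀) (⇀-total h) , λ (p , q) → ⇀-asym (to-⇀ p) (to-⇀ q)) ,
      (λ a b p → proj₁ (to-⇀ p)) ,
      (λ a b c p q → from-⇀ (⇀-trans (to-⇀ p) (to-⇀ q)))
      where
      to-⇀ : ∀ {a b} → does (a ⇀? b) ≡ true → a ⇀ b
      to-⇀ {a} {b} = true⇒ (a ⇀? b)
      from-⇀ : ∀ {a b} → a ⇀ b → does (a ⇀? b) ≡ true
      from-⇀ {a} {b} = dec-true (a ⇀? b)

-- The independence graph of a bipartite graph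

module Theorem {m n : ℕ} (adj : Fin m → Fin n → Bool) where
  open Bipartite adj

  E? : ∀ x y → Dec (E x y)
  E? x y = adj x y Bool.≟ true

  E-irr : ∀ {x y} (p q : E x y) → p ≡ q
  E-irr = Decidable⇒UIP.≡-irrelevant Bool._≟_

  Edge-≡ : ∀ {x y x' y'} {e : E x y} {e' : E x' y'} → x ≡ x' → y ≡ y' →
           _≡_ {A = Edge} ((x , y) , e) ((x' , y') , e')
  Edge-≡ refl refl = cong (_ ,_) (E-irr _ _)

  _≟E_ : DecidableEquality Edge
  ((x , y) , e) ≟E ((x' , y') , e') with x ≟ x' | y ≟ y'
  ... | yes p | yes q = yes (Edge-≡ p q)
  ... | no p  | _     = no λ { refl → p refl }
  ... | yes _ | no q  = no λ { refl → q refl }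

  Indep-sym : ∀ {x y x' y'} → IndepXY x y x' y' → IndepXY x' y' x y
  Indep-sym (e , e' , p , q , r , s) = e' , e , (λ t → p (sym t)) , (λ t → q (sym t)) , s , r

  -- Disjointness is automatic: a shared end would turn a given edge into an excluded one.
  indep : ∀ {x y x' y'} → E x y → E x' y' → ¬ E x y' → ¬ E x' y → IndepXY x y x' y'
  indep e e' r s = e , e' , (λ { refl → r e' }) , (λ { refl → r e }) , r , s

  dependent : ∀ {x y x' y'} → E x y → E x' y' → ¬ IndepXY x y x' y' → E x y' ⊎ E x' y
  dependent {x} {y} {x'} {y'} e e' n with E? x y' | E? x' y
  ... | yes p | _     = inj₁ p
  ... | no _  | yes p = inj₂ p
  ... | no p  | no q  = ⊥-elim (n (indep e e' p q))

  IG-sym : ∀ {e f} → IG e f → IG f e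
  IG-sym = Indep-sym

  IG-irr : ∀ {e} → ¬ IG e e
  IG-irr (_ , _ , p , _) = p refl

  IG? : ∀ e f → Dec (IG e f)
  IG? ((x , y) , e) ((x' , y') , e') with E? x y' | E? x' y
  ... | yes p | _     = no λ (_ , _ , _ , _ , q , _) → q p
  ... | no _  | yes p = no λ (_ , _ , _ , _ , _ , q) → q p
  ... | no p  | no q  = yes (indep e e' p q)

  open ForcingWalks {Edge} IG (λ {e} {f} → IG-sym {e} {f}) (λ {e} → IG-irr {e}) IG?
    using (Walk; turn; cross; _⊢_≈_; ≈-sym; ≈-nbr; no-odd-closed-walk; module Orientation)

  NoOddClosedWalk : Set
  NoOddClosedWalk = ∀ {L s} → Walk L s s → parity L ≢ 1ℙ

  edgesFrom : List (Fin m × Fin n) → List Edge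
  edgesFrom [] = []
  edgesFrom ((x , y) ∷ ps) with E? x y
  ... | yes e = ((x , y) , e) ∷ edgesFrom ps
  ... | no _  = edgesFrom ps

  ∈-edgesFrom : ∀ {ps x y} (e : E x y) → (x , y) ∈ ps → ((x , y) , e) ∈ edgesFrom ps
  ∈-edgesFrom {(x , y) ∷ _} e (here refl) with E? x y
  ... | yes _ = here (Edge-≡ refl refl)
  ... | no n  = ⊥-elim (n e)
  ∈-edgesFrom {(x , y) ∷ _} e (there i) with E? x y
  ... | yes _ = there (∈-edgesFrom e i)
  ... | no _  = ∈-edgesFrom e i

  noOddClosedWalk⇒comparability : NoOddClosedWalk → Cond1
  noOddClosedWalk⇒comparability no-odd =
    Orientation.comparability _≟E_
      (edgesFrom (cartesianProduct (allFin m) (allFin n)))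
      (λ ((x , y) , e) → ∈-edgesFrom e (∈-cartesianProduct⁺ (∈-allFin x) (∈-allFin y)))
      (λ ((x , y) , _) → combine x y)
      (λ {((x , y) , _)} {((x' , y') , _)} eq →
        let p , q = combine-injective x y x' y' eq in Edge-≡ p q)
      no-odd

  noAsteroid⇒noOddClosedWalk : Cond6 → NoOddClosedWalk
  noAsteroid⇒noOddClosedWalk = no-odd-closed-walk _≟E_

  -- From a transitive orientation to a T-free one.

  comparability⇒TFree : Cond1 → Cond2
  comparability⇒TFree (O , orient , O⇒IG , O-trans) =
    X.tournament , Y.tournament , (X.irrefl , X.exactlyOne) , (Y.irrefl , Y.exactlyOne) , tfree
    where
    Arc : Fin m → Fin n → Fin m → Fin n → Set
    Arc x y x' y' = Σ (E x y) λ e → Σ (E x' y') λ e' → O ((x , y) , e) ((x' , y') , e') ≡ true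

    arc? : ∀ x y x' y' → Dec (Arc x y x' y')
    arc? x y x' y' with E? x y | E? x' y'
    ... | no n  | _     = no λ (e , _) → n e
    ... | yes _ | no n  = no λ (_ , e' , _) → n e'
    ... | yes e | yes e' = map′ (λ o → e , e' , o)
      (λ (f , f' , o) → subst₂ (λ f f' → O (_ , f) (_ , f') ≡ true) (E-irr f e) (E-irr f' e') o)
      (O ((x , y) , e) ((x' , y') , e') Bool.≟ true)

    arc-indep : ∀ {x y x' y'} → Arc x y x' y' → IndepXY x y x' y'
    arc-indep (_ , _ , o) = O⇒IG _ _ o

    arc-trans : ∀ {x y x' y' x'' y''} → Arc x y x' y' → Arc x' y' x'' y'' → Arc x y x'' y''
    arc-trans (e , e' , o) (f , f' , o') =
      e , f' , O-trans _ _ _ o (subst (λ f → O (_ , f) _ ≡ true) (E-irr f e') o')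

    arc-irrefl : ∀ {x y x' y'} → Arc x y x' y' → E x y' → ⊥
    arc-irrefl a e with arc-indep a
    ... | _ , _ , _ , _ , n , _ = n e

    arc-total : ∀ {x y x' y'} → IndepXY x y x' y' → Arc x y x' y' ⊎ Arc x' y' x y
    arc-total i@(e , e' , _) = Sum.map (λ o → e , e' , o) (λ o → e' , e , o)
      (proj₁ (orient (_ , e) (_ , e') i))

    -- The opposite arc would give, by transitivity, an arc from `xy` to `zw`, which are not
    -- independent.
    force : ∀ {x y z w x' y'} → Arc x y x' y' → IndepXY z w x' y' → E x w ⊎ E z y → Arc z w x' y'
    force a i d with arc-total i
    ... | inj₁ b = b
    ... | inj₂ b with arc-indep (arc-trans a b) | d
    ...   | _ , _ , _ , _ , p , _ | inj₁ e = ⊥-elim (p e)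
    ...   | _ , _ , _ , _ , _ , q | inj₂ e = ⊥-elim (q e)

    DX : Fin m → Fin m → Set
    DX x x' = ∃₂ λ y y' → Arc x y x' y'

    DY : Fin n → Fin n → Set
    DY y y' = ∃₂ λ x x' → Arc x y x' y'

    -- `force` moves the source of the first arc to the edge where the second arc ends. Transitivity
    -- then yields an arc between two edges at `x'`.
    DX-asym : ∀ {x x'} → DX x x' → ¬ DX x' x
    DX-asym (y , y' , a) (z' , z , b) with arc-indep a | arc-indep b
    ... | e , e' , _ , _ , p , _ | f' , f , _ , _ , q , _ =
      arc-irrefl (arc-trans b (force a (indep f e' p q) (inj₁ f))) e'

    DY-asym : ∀ {y y'} → DY y y' → ¬ DY y' y
    DY-asym (x , x' , a) (z' , z , b) with arc-indep a | arc-indep b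
    ... | e , e' , _ , _ , _ , p | f' , f , _ , _ , _ , q =
      arc-irrefl (arc-trans b (force a (indep f e' q p) (inj₂ f))) f'

    module X = Completion (λ x x' → any? λ y → any? λ y' → arc? x y x' y') (λ {a} {b} → DX-asym {a} {b})
    module Y = Completion (λ y y' → any? λ x → any? λ x' → arc? x y x' y') (λ {a} {b} → DY-asym {a} {b})

    tfree : TFree X.tournament Y.tournament
    -- The edges `xy'` and `x'y` are independent, and either direction of their arc contradicts one
    -- of the tournaments.
    tfree x x' y y' (n , n' , e , e' , tx , ty) with arc-total (indep e e' n n')
    ... | inj₁ a = Y.D⇒ {y} {y'} ty (x , x' , a)
    ... | inj₂ a = X.D⇒ {x} {x'} tx (y , y' , a)

  -- Obstructions excluded by a T-free orientation.

  module FromTFree {RX RY} (tX : IsTournament RX) (tY : IsTournament RY) (free : TFree RX RY) where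

    reversed : ∀ {W : Set} {R : W → W → Bool} → IsTournament R → ∀ {a b} → a ≢ b → R b a ≡ not (R a b)
    reversed {R = R} (_ , one) {a} {b} a≢b with R a b in p | R b a in q | one a b a≢b
    ... | true  | true  | _ , n       = ⊥-elim (n (refl , refl))
    ... | true  | false | _           = refl
    ... | false | true  | _           = refl
    ... | false | false | inj₁ () , _
    ... | false | false | inj₂ () , _

    -- If the two values differed, reversing the false one would produce the forbidden pattern.
    agree : ∀ {x y x' y'} → IndepXY x y x' y' → RX x x' ≡ RY y y'
    agree {x} {y} {x'} {y'} (e , e' , p , q , r , s) with RX x x' in px | RY y y' in py
    ... | true  | true  = refl
    ... | false | false = refl
    ... | true  | false = ⊥-elim (free x x' y' y (r , s , e , e' , px , trans (reversed tY q) (cong not py)))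
    ... | false | true  = ⊥-elim (free x' x y y' (s , r , e' , e , trans (reversed tX p) (cong not px) , py))

    value : Vtx → Vtx → Bool
    value (inj₁ x) (inj₁ x') = RX x x'
    value (inj₂ y) (inj₂ y') = RY y y'
    value _        _         = false

    value-step : ∀ p q → CongStep p q → value (proj₁ p) (proj₂ p) ≡ value (proj₁ q) (proj₂ q)
    value-step (inj₁ _ , inj₁ _) (inj₂ _ , inj₂ _) i = agree i
    value-step (inj₂ _ , inj₂ _) (inj₁ _ , inj₁ _) i = sym (agree i)

    value-walk : ∀ p rest → Linked CongStep (p ∷ rest) →
                 value (proj₁ p) (proj₂ p) ≡ value (proj₁ (lastOr p rest)) (proj₂ (lastOr p rest))
    value-walk p []         _        = refl
    value-walk p (q ∷ rest) (s ∷ lk) = trans (value-step p q s) (value-walk q rest lk)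

    value-swap : ∀ u v → SamePart u v → u ≢ v → value v u ≡ not (value u v)
    value-swap (inj₁ _) (inj₁ _) _ ne = reversed tX λ { refl → ne refl }
    value-swap (inj₂ _) (inj₂ _) _ ne = reversed tY λ { refl → ne refl }

    noInvertiblePair : Cond3
    noInvertiblePair (u , v , u≢v , same , walk rest lk ends) =
      Bool.not-¬ refl (trans (value-walk (u , v) rest lk)
        (trans (cong (λ p → value (proj₁ p) (proj₂ p)) ends) (value-swap u v same u≢v)))

    -- The direction from the edge xy to a vertex of a walk that avoids its
    -- neighbourhood does not change along the walk.
    towards : Fin m → Fin n → Vtx → Bool
    towards x y (inj₁ x') = RX x x'
    towards x y (inj₂ y') = RY y y'

    Avoids : Fin m → Fin n → Vtx → Set
    Avoids x y w = ¬ Adj w (inj₁ x) × ¬ Adj w (inj₂ y)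

    towards-step : ∀ {x y} → E x y → ∀ u w → Avoids x y u → Avoids x y w → Adj u w →
                   towards x y u ≡ towards x y w
    towards-step e (inj₁ _) (inj₂ _) (_ , s) (r , _) a = agree (indep e a r s)
    towards-step e (inj₂ _) (inj₁ _) (r , _) (_ , s) a = sym (agree (indep e a r s))

    towards-head : ∀ {x y} → E x y → ∀ {w ws} → Linked Adj (w ∷ ws) → All (Avoids x y) (w ∷ ws) →
                   ∀ {u} → u ∈ w ∷ ws → towards x y w ≡ towards x y u
    towards-head e _ _ (here refl) = refl
    towards-head e (a ∷ lk) (v ∷ v' ∷ vs) (there i) =
      trans (towards-step e _ _ v v' a) (towards-head e lk (v' ∷ vs) i)

    towards-const : ∀ {x y} → E x y → ∀ {ws} → Linked Adj ws → All (Avoids x y) ws →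
                    ∀ {u u'} → u ∈ ws → u' ∈ ws → towards x y u ≡ towards x y u'
    towards-const e {_ ∷ _} lk vs i i' = trans (sym (towards-head e lk vs i)) (towards-head e lk vs i')

    -- The shift by `k + 1` negates `forward`. Twice this shift is the shift by 1 modulo `2k + 1`,
    -- so `forward` is also constant.
    noWeakEdgeAsteroid : Cond4
    noWeakEdgeAsteroid (k , _ , e , cond) =
      Bool.not-¬ refl (trans (sym (constant (suc k))) (alternates zero))
      where
      x : Fin (suc (k + k)) → Fin m
      x i = proj₁ (proj₁ (e i))

      forward : Fin (suc (k + k)) → Bool
      forward i = RX (x i) (x (i ⊕ k))

      alternates : ∀ i → forward (i ⊕ suc k) ≡ not (forward i)
      alternates i with cond i
      ... | ws , lk , (in₁ , _) , (in₂ , in₃) , avoid = begin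
        RX (x (i ⊕ suc k)) (x ((i ⊕ suc k) ⊕ k)) ≡⟨ cong (RX (x (i ⊕ suc k)) ∘ x) (trans (⊕-assoc i (suc k) k) (⊕-full i)) ⟩
        RX (x (i ⊕ suc k)) (x i)                 ≡⟨ reversed tX distinct ⟩
        not (RX (x i) (x (i ⊕ suc k)))           ≡⟨ cong not (towards-const (proj₂ (e i)) lk avoid in₂ in₁) ⟩
        not (forward i)                          ∎
        where
        open ≡-Reasoning
        distinct : x i ≢ x (i ⊕ suc k)
        distinct eq = proj₁ (All.lookup avoid in₃) (subst (λ z → E z (proj₂ (proj₁ (e (i ⊕ suc k))))) (sym eq) (proj₂ (e (i ⊕ suc k))))

      step : ∀ i → forward (i ⊕ 1) ≡ forward i
      step i = begin
        forward (i ⊕ 1)                 ≡⟨ cong (λ j → forward (j ⊕ 1)) (⊕-full i) ⟨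
        forward ((i ⊕ suc (k + k)) ⊕ 1) ≡⟨ cong forward (⊕-assoc i (suc (k + k)) 1) ⟩
        forward (i ⊕ (suc (k + k) + 1)) ≡⟨ cong (λ j → forward (i ⊕ j)) (twice k) ⟩
        forward (i ⊕ (suc k + suc k))   ≡⟨ cong forward (⊕-assoc i (suc k) (suc k)) ⟨
        forward ((i ⊕ suc k) ⊕ suc k)   ≡⟨ alternates (i ⊕ suc k) ⟩
        not (forward (i ⊕ suc k))       ≡⟨ cong not (alternates i) ⟩
        not (not (forward i))           ≡⟨ Bool.not-involutive _ ⟩
        forward i                       ∎
        where
        open ≡-Reasoning
        twice : ∀ k → suc (k + k) + 1 ≡ suc k + suc k
        twice = solve-∀

      constant : ∀ j → forward (zero ⊕ j) ≡ forward zero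
      constant zero    = refl
      constant (suc j) = trans (cong forward (trans (cong (zero ⊕_) (+-comm 1 j)) (sym (⊕-assoc zero j 1)))) (trans (step (zero ⊕ j)) (constant j))

  -- Edge-asteroids from asteroids.

  coIG-sym : ∀ {e f} → coIG e f → coIG f e
  coIG-sym (p , q) = (λ t → p (sym t)) , λ t → q (Indep-sym t)

  -- A non-neighbour of `v` in the complement is independent of `v` or is `v` itself, and a path
  -- could enter `v` only from a neighbour.
  path-independent : ∀ {v a} rest → v ≢ a → Linked coIG (a ∷ rest) →
    All (λ w → ¬ coIG v w) (a ∷ rest) → All (IG v) (a ∷ rest)
  path-independent {v} {a} rest v≢a lk (n ∷ ns) = vIa ∷ tail rest lk ns
    where
    vIa : IG v a
    vIa = decidable-stable (IG? v a) λ k → n (v≢a , k)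
    tail : ∀ rest → Linked coIG (a ∷ rest) → All (λ w → ¬ coIG v w) rest → All (IG v) rest
    tail []         _        _  = []
    tail (b ∷ rest) (c ∷ lk) ns =
      path-independent {v} rest (λ { refl → n (coIG-sym {a} {b} c) }) lk ns

  -- An edge of G joins any two dependent edges. Since the walk must start with `x` and then `y`, a
  -- joining edge at `x` costs a return to `x`.
  expand : ∀ {v} a rest → Linked coIG (a ∷ rest) → All (IG v) (a ∷ rest) →
    Σ (List Vtx) λ ws → let ws⁺ = inj₁ (proj₁ (proj₁ a)) ∷ inj₂ (proj₂ (proj₁ a)) ∷ ws in
      Linked Adj ws⁺ × endsIn (lastOr a rest) ws⁺ × avoidsNbhd v ws⁺
  expand ((x , y) , e) [] _ ((_ , _ , _ , _ , p , q) ∷ []) =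
    [] , e ∷ [-] , (here refl , there (here refl)) , ((λ ()) , q) ∷ (p , λ ()) ∷ []
  expand {v} ((x , y) , e) (b@((x' , y') , e') ∷ rest) ((_ , n) ∷ lk) ((_ , _ , _ , _ , p , q) ∷ is@((_ , _ , _ , _ , p' , q') ∷ _))
    with expand {v} b rest lk is | dependent e e' n
  ... | ws , lk' , (in₁ , in₂) , avoid | inj₂ d =
    inj₁ x' ∷ inj₂ y' ∷ ws , e ∷ d ∷ lk' , (there (there in₁) , there (there in₂)) , ((λ ()) , q) ∷ (p , λ ()) ∷ avoid
  ... | ws , lk' , (in₁ , in₂) , avoid | inj₁ d =
    inj₁ x ∷ inj₂ y' ∷ inj₁ x' ∷ inj₂ y' ∷ ws , e ∷ e ∷ d ∷ e' ∷ lk' , (there (there (there (there in₁))) , there (there (there (there in₂)))) ,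
    ((λ ()) , q) ∷ (p , λ ()) ∷ ((λ ()) , q) ∷ (p' , λ ()) ∷ avoid

  asteroid⇒edgeAsteroid : Asteroid coIG → EdgeAsteroid
  asteroid⇒edgeAsteroid (k , 1≤k , v , v-inj , cond) = k , 1≤k , v , v-inj , walks
    where
    walks : EdgeAsteroidCond k v
    walks i with cond i
    ... | path rest lk ends _ , avoid
      with expand {v i} (v (i ⊕ k)) rest lk (path-independent {v i} rest (λ eq → ⊕k≢ 1≤k i (sym (v-inj eq))) lk avoid)
    ...   | ws , lk' , last , av =
      _ , lk' , (here refl , there (here refl)) , subst (λ b → endsIn b _) ends last , av

  -- Invertible pairs from odd closed walks.

  pairOf : Edge × Edge → Vtx × Vtx
  pairOf (((x , _) , _) , ((x' , _) , _)) = inj₁ x , inj₁ x'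

  _⇝_ : Vtx × Vtx → Vtx × Vtx → Set
  _⇝_ = Star CongStep

  cong-swap : ∀ {p q} → CongStep p q → CongStep (swap p) (swap q)
  cong-swap {inj₁ _ , inj₁ _} {inj₂ _ , inj₂ _} i = Indep-sym i
  cong-swap {inj₂ _ , inj₂ _} {inj₁ _ , inj₁ _} i = Indep-sym i

  -- The first walk goes along `e` and back, while the second uses the edge joining the two
  -- dependent edges, through `y''` or `y'`.
  ≈⇒cong : ∀ {e f f'} → e ⊢ f ≈ f' → pairOf (e , f) ⇝ pairOf (e , f')
  ≈⇒cong ε = ε
  ≈⇒cong {g} (_◅_ {i = (x' , y') , e'} {j = (x'' , y'') , e''} (i@(e , _ , _ , _ , p , q) , i'@(_ , _ , _ , _ , p' , q') , n) c)
    with dependent e' e'' n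
  ... | inj₁ d = _◅_ {j = inj₂ _ , inj₂ y''} (indep e d p' q) (i' ◅ ≈⇒cong {g} c)
  ... | inj₂ d = _◅_ {j = inj₂ _ , inj₂ y'} i (indep e d p q' ◅ ≈⇒cong {g} c)

  orient : Parity → Vtx × Vtx → Vtx × Vtx
  orient 0ℙ p = p
  orient 1ℙ p = swap p

  -- Each crossing exchanges the two edges, so an odd closed walk ends at the swapped pair.
  walk⇒cong : ∀ {L s t} → Walk L s t → pairOf s ⇝ orient (parity L) (pairOf t)
  walk⇒cong (turn {u} c) = ≈⇒cong {u} c
  walk⇒cong {suc L} {t = t} (cross {u = u} c h W) =
    ≈⇒cong {u} c ◅◅ subst (_ ⇝_) eq (gmap swap (λ {p} {q} → cong-swap {p} {q}) (walk⇒cong W))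
    where
    eq : swap (orient (parity L) (pairOf t)) ≡ orient (parity (suc L)) (pairOf t)
    eq rewrite parity-suc L with parity L
    ... | 0ℙ = refl
    ... | 1ℙ = refl

  cong⇒walk : ∀ {p q} → p ⇝ q → WalkFromTo CongStep p q
  cong⇒walk ε = walk [] [-] refl
  cong⇒walk (s ◅ c) with cong⇒walk c
  ... | walk rest lk ends = walk (_ ∷ rest) (s ∷ lk) ends

  noInvertiblePair⇒noOddClosedWalk : Cond3 → NoOddClosedWalk
  noInvertiblePair⇒noOddClosedWalk c3 W@(cross {u = u} c h _) odd =
    c3 (_ , _ , (λ { refl → x≢x' refl }) , tt ,
        cong⇒walk (subst (λ π → _ ⇝ orient π _) odd (walk⇒cong W)))
    where
    x≢x' : _
    x≢x' = proj₁ (proj₂ (proj₂ (≈-nbr {u} h (≈-sym {u} c))))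

theorem2p6 : {m n : ℕ} (adj : Fin m → Fin n → Bool) →
    let open Bipartite adj in
    (Cond1 ⇔ Cond2) × (Cond2 ⇔ Cond3) × (Cond3 ⇔ Cond4) ×
    (Cond4 ⇔ Cond5) × (Cond5 ⇔ Cond6)
theorem2p6 adj =
  -- Every converse passes through `NoOddClosedWalk`, which follows from (iii) and from (vi) and
  -- implies (i).
  mk⇔ i⇒ii (λ c → w⇒i (iii⇒w (ii⇒iii c))) ,
  mk⇔ ii⇒iii (λ c → i⇒ii (w⇒i (iii⇒w c))) ,
  mk⇔ (λ c → ii⇒iv (i⇒ii (w⇒i (iii⇒w c)))) (λ c → ii⇒iii (i⇒ii (w⇒i (vi⇒w (v⇒vi (iv⇒v c)))))) ,
  mk⇔ iv⇒v (λ c → ii⇒iv (i⇒ii (w⇒i (vi⇒w (v⇒vi c))))) ,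
  mk⇔ v⇒vi (λ c → iv⇒v (ii⇒iv (i⇒ii (w⇒i (vi⇒w c)))))
  where
  open Bipartite adj
  open Theorem adj
  i⇒ii : Cond1 → Cond2
  i⇒ii = comparability⇒TFree
  ii⇒iii : Cond2 → Cond3
  ii⇒iii (_ , _ , tX , tY , free) = FromTFree.noInvertiblePair tX tY free
  iii⇒w : Cond3 → NoOddClosedWalk
  iii⇒w = noInvertiblePair⇒noOddClosedWalk
  w⇒i : NoOddClosedWalk → Cond1
  w⇒i = noOddClosedWalk⇒comparability
  ii⇒iv : Cond2 → Cond4
  ii⇒iv (_ , _ , tX , tY , free) = FromTFree.noWeakEdgeAsteroid tX tY free
  iv⇒v : Cond4 → Cond5
  iv⇒v c4 (k , 1≤k , e , _ , cond) = c4 (k , 1≤k , e , cond)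
  v⇒vi : Cond5 → Cond6
  v⇒vi c5 ast = c5 (asteroid⇒edgeAsteroid ast)
  vi⇒w : Cond6 → NoOddClosedWalk
  vi⇒w = noAsteroid⇒noOddClosedWalk
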